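{- There is an isolation scheme for Hamiltonian cycles in undirected graphs that uses $\mathcal{O}(n)$ random bits and assigns weights upper bounded by $2^{\mathcal{O}(n)}$. That is, there is an absolute constant $C$ such that for all $n,m\in\mathbb{N}$ there exist weight functions $\omega_1,\ldots,\omega_\ell\colon[m]\to\mathbb{N}$ with $\log\ell\le Cn$ and all values at most $2^{Cn}$, such that for every undirected $n$-vertex graph $G$ whose edge set is identified with $[m]$, at least half of the indices $i\in[\ell]$ satisfy: $\omega_i$ isolates the family $\mathsf{HC}(G)$.
   Context: For a finite set $U$, a weight function $\omega\colon U\to\mathbb{N}$ and $X\subseteq U$, write $\omega(X)=\sum_{e\in X}\omega(e)$. A weight function $\omega$ isolates a family $\mathcal{F}\subseteq 2^U$ if there is exactly one $S\in\mathcal{F}$ with $\omega(S)=\min_{S'\in\mathcal{F}}\omega(S')$. $\mathsf{HC}(G)$ is the family of edge sets of Hamiltonian cycles of $G$. An isolation scheme for an edge selection problem on a graph class provides, for every $m$, weight functions $\omega_1,\ldots,\omega_\ell\colon[m]\to\mathbb{N}$ such that for every graph in the class with edges enumerated by $[m]$, at least half of the $\omega_i$ isolate the family; the number of random bits is $\log\ell$ and the maximum weight is the maximum value taken by any $\omega_i$. Here $[k]=\{1,\ldots,k\}$.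
   Formalization: The claim is stated only for graphs G that have at least one Hamiltonian cycle; if HC(G) is empty, no weight function can isolate it, so the claim for every undirected graph fails as written. -}

module Defs where

open import Data.Nat using (ℕ; zero; suc; _+_; _*_; _^_; _≤_; _<_)
open import Data.Fin using (Fin; toℕ)
open import Data.Fin.Subset using (Subset; _∈_; ∣_∣)
open import Data.Vec using (Vec; tabulate; lookup)
open import Data.Bool using (Bool; true; false; if_then_else_)
open import Data.Nat.ListAction using (sum)
open import Data.Vec using (toList)
open import Data.Product using (Σ; ∃; ∃-syntax; _×_; _,_; proj₁; proj₂)
open import Data.Sum using (_⊎_)
open import Function.Definitions using (Injective)
open import Relation.Binary.PropositionalEquality using (_≡_)
open import Relation.Nullary using (¬_)

-- A finite simple undirected graph on vertex set Fin n whose edge set is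
-- enumerated by Fin m: edge j is the unordered pair {u , v} with u < v,
-- stored canonically as (u , v); distinct indices give distinct edges.
record Graph (n m : ℕ) : Set where
  field
    edge      : Fin m → Fin n × Fin n
    ordered   : ∀ j → toℕ (proj₁ (edge j)) < toℕ (proj₂ (edge j))
    edge-inj  : Injective _≡_ _≡_ edge
open Graph public

Joins : ∀ {n m} → Graph n m → Fin m → Fin n → Fin n → Set
Joins G j u v = (edge G j ≡ (u , v)) ⊎ (edge G j ≡ (v , u))

Next : ∀ {n} → Fin n → Fin n → Set
Next {n} i k = (suc (toℕ i) ≡ toℕ k) ⊎ ((suc (toℕ i) ≡ n) × (toℕ k ≡ 0))

IsHC : ∀ {n m} → Graph n m → Subset m → Set
IsHC {n} {m} G S =
  (3 ≤ n) ×
  Σ (Fin n → Fin n) λ σ →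
    Injective _≡_ _≡_ σ ×
    (∀ i k → Next i k → ∃[ j ] (j ∈ S × Joins G j (σ i) (σ k))) ×
    (∀ j → j ∈ S → ∃[ i ] ∃[ k ] (Next i k × Joins G j (σ i) (σ k)))

weight : ∀ {m} → (Fin m → ℕ) → Subset m → ℕ
weight {m} ω S = sum (toList (tabulate λ j → if lookup S j then ω j else 0))

IsolatesHC : ∀ {n m} → (Fin m → ℕ) → Graph n m → Set
IsolatesHC {n} {m} ω G =
  Σ (Subset m) λ S →
    IsHC G S ×
    (∀ S' → IsHC G S' → weight ω S ≤ weight ω S') ×
    (∀ S' → IsHC G S' → weight ω S' ≡ weight ω S → S' ≡ S)

Hamiltonian : ∀ {n m} → Graph n m → Set
Hamiltonian {n} {m} G = ∃[ S ] IsHC G S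

{-# OPTIONS --safe #-}
module Submission where

-- Only existence is claimed, so the probabilistic method suffices. For one fixed graph,
-- the isolation lemma of Mulmuley, Vazirani and Vazirani says that weights drawn from
-- N values fail with probability at most m / N. There are at most (n²)^m graphs with
-- enumerated edges, so ℓ = O(n m) independent draws with N = O(m) beat a union bound over
-- all of them; the draws are derandomised by the method of conditional expectations, with
-- the potential ∑ 16^#failures over all graphs. For m > n² there is no graph at all.

open import Defs
open import Data.Nat using (ℕ; _*_; _^_; _≤_; _<_)
open import Data.Fin using (Fin)
open import Data.Fin.Subset using (Subset; _∈_; ∣_∣)
open import Data.Product using (Σ; ∃; ∃-syntax; _×_)

import Algebra.Properties.Semiring.Sum as SemiringSum
open import Data.Bool using (true; false; if_then_else_)
open import Data.Fin using (zero; suc; toℕ; combine; remQuot; finToFun; funToFin)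
open import Data.Fin.Properties using (any?; all?; _≟_; toℕ<n; toℕ-injective; remQuot-combine;
  combine-injective; finToFun-funToFin; injective⇒≤; suc-injective)
open import Data.Fin.Subset using (_∉_; ∁)
open import Data.Fin.Subset.Properties using (_∈?_; anySubset?; ⊆-antisym; ∣∁p∣≡n∸∣p∣; x∈∁p⇒x∉p)
open import Data.Nat using (zero; suc; _+_; _∸_; NonZero; z≤n; s≤s; _≤?_; _<?_)
open import Data.Nat.Induction using (Acc; acc; <-wellFounded)
open import Data.Nat.Properties hiding (suc-injective) renaming (_≟_ to _≟ℕ_)
open import Data.Nat.Tactic.RingSolver using (solve-∀)
open import Data.Product using (_,_; proj₁; proj₂)
open import Data.Product.Properties using () renaming (≡-dec to ×-≡-dec)
open import Data.Sum using (_⊎_)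
open import Data.Vec using (Vec; []; _∷_; lookup; map; here; there)
open import Data.Vec.Properties using (lookup-map; lookup⇒[]=)
open import Function using (_∘_)
open import Function.Definitions using (Injective)
open import Relation.Binary.Definitions using (tri<; tri≈; tri>)
open import Relation.Binary.PropositionalEquality
open import Relation.Nullary using (¬_; Dec; yes; no; does; contradiction)
open import Relation.Nullary.Decidable using (map′; ¬?; _×-dec_; _⊎-dec_; _→-dec_; dec-true; decidable-stable)
open import Relation.Unary using (Decidable)

open SemiringSum +-*-semiring using (sum; sum-syntax; sum-cong-≗; ∑-distrib-+; ∑-comm; *-distribˡ-sum)

private
  variable
    k l m n N Q : ℕ

-- Finite sums and indicators

∑-mono : {f g : Fin n → ℕ} → (∀ i → f i ≤ g i) → sum f ≤ sum g
∑-mono {zero}  f≤g = z≤n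
∑-mono {suc n} f≤g = +-mono-≤ (f≤g zero) (∑-mono (f≤g ∘ suc))

∑-const : ∀ n c → ∑[ i < n ] c ≡ n * c
∑-const zero    c = refl
∑-const (suc n) c = cong (c +_) (∑-const n c)

term≤∑ : (f : Fin n → ℕ) → ∀ i → f i ≤ sum f
term≤∑ f zero    = m≤m+n _ _
term≤∑ f (suc i) = ≤-trans (term≤∑ (f ∘ suc) i) (m≤n+m _ _)

∑-average : .{{NonZero n}} → (f : Fin n → ℕ) → sum f ≤ n * k → ∃[ i ] f i ≤ k
∑-average {n} {k} f ∑f≤ with any? (λ i → f i ≤? k)
... | yes small = small
... | no ¬small = contradiction (*-cancelˡ-≤ n large) 1+n≰n
  where
  large : n * suc k ≤ n * k
  large = begin
    n * suc k         ≡⟨ ∑-const n (suc k) ⟨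
    ∑[ i < n ] suc k  ≤⟨ ∑-mono (λ i → ≰⇒> (λ fi≤k → ¬small (i , fi≤k))) ⟩
    sum f             ≤⟨ ∑f≤ ⟩
    n * k             ∎
    where open ≤-Reasoning

𝟙 : {A : Set} → Dec A → ℕ
𝟙 (yes _) = 1
𝟙 (no _)  = 0

𝟙-any≤∑ : {A : Fin n → Set} (A? : Decidable A) (∃A? : Dec (∃ A)) → 𝟙 ∃A? ≤ ∑[ i < n ] 𝟙 (A? i)
𝟙-any≤∑ A? (no _) = z≤n
𝟙-any≤∑ A? (yes (i , a)) with A? i | term≤∑ (λ j → 𝟙 (A? j)) i
... | yes _ | 1≤∑ = 1≤∑
... | no ¬a | _   = contradiction a ¬a

∑-𝟙-unique : {A : Fin n → Set} (A? : Decidable A) → (∀ i j → A i → A j → i ≡ j) →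
             ∑[ i < n ] 𝟙 (A? i) ≤ 1
∑-𝟙-unique {zero}  A? uniq = z≤n
∑-𝟙-unique {suc n} A? uniq with A? zero
... | no _  = ∑-𝟙-unique (A? ∘ suc) (λ i j a b → suc-injective (uniq _ _ a b))
... | yes a = s≤s (≤-reflexive (trans (sum-cong-≗ none) (trans (∑-const n 0) (*-zeroʳ n))))
  where
  none : ∀ i → 𝟙 (A? (suc i)) ≡ 0
  none i with A? (suc i)
  ... | no _  = refl
  ... | yes b = contradiction (uniq _ _ a b) λ ()

-- Counting and averaging over all vectors

∑ⱽ : ∀ N m → (Vec (Fin N) m → ℕ) → ℕ
∑ⱽ N zero    f = f []
∑ⱽ N (suc m) f = ∑[ x < N ] ∑ⱽ N m (λ v → f (x ∷ v))

∑ⱽ-mono : ∀ m {f g : Vec (Fin N) m → ℕ} → (∀ v → f v ≤ g v) → ∑ⱽ N m f ≤ ∑ⱽ N m g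
∑ⱽ-mono zero    f≤g = f≤g []
∑ⱽ-mono (suc m) f≤g = ∑-mono (λ x → ∑ⱽ-mono m (f≤g ∘ (x ∷_)))

∑ⱽ-const : ∀ N m c → ∑ⱽ N m (λ _ → c) ≡ N ^ m * c
∑ⱽ-const N zero    c = sym (+-identityʳ c)
∑ⱽ-const N (suc m) c = begin
  ∑[ x < N ] ∑ⱽ N m (λ _ → c)  ≡⟨ ∑-const N _ ⟩
  N * ∑ⱽ N m (λ _ → c)         ≡⟨ cong (N *_) (∑ⱽ-const N m c) ⟩
  N * (N ^ m * c)              ≡⟨ *-assoc N (N ^ m) c ⟨
  N * N ^ m * c                ∎
  where open ≡-Reasoning

∑ⱽ-*ˡ : ∀ m c (f : Vec (Fin N) m → ℕ) → ∑ⱽ N m (λ v → c * f v) ≡ c * ∑ⱽ N m f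
∑ⱽ-*ˡ zero    c f = refl
∑ⱽ-*ˡ {N} (suc m) c f = trans (sum-cong-≗ (λ x → ∑ⱽ-*ˡ m c (f ∘ (x ∷_)))) (sym (*-distribˡ-sum {N} c _))

∑ⱽ-∑-comm : ∀ m (f : Fin k → Vec (Fin N) m → ℕ) →
            ∑ⱽ N m (λ v → ∑[ i < k ] f i v) ≡ ∑[ i < k ] ∑ⱽ N m (f i)
∑ⱽ-∑-comm zero    f = refl
∑ⱽ-∑-comm (suc m) f =
  trans (sum-cong-≗ (λ x → ∑ⱽ-∑-comm m (λ i v → f i (x ∷ v)))) (∑-comm (λ x i → ∑ⱽ _ m (λ v → f i (x ∷ v))))

-- Conditional expectations: the coordinates are fixed one at a time, each so that the average over
-- the remaining ones stays at most `k`.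
∑ⱽ-average : .{{NonZero N}} → ∀ m (f : Vec (Fin N) m → ℕ) → ∑ⱽ N m f ≤ N ^ m * k → ∃[ v ] f v ≤ k
∑ⱽ-average         zero    f ∑f≤ = [] , ≤-trans ∑f≤ (≤-reflexive (+-identityʳ _))
∑ⱽ-average {N} {k} (suc m) f ∑f≤ with ∑-average _ (≤-trans ∑f≤ (≤-reflexive (*-assoc N (N ^ m) k)))
... | x , fx≤ with ∑ⱽ-average m (f ∘ (x ∷_)) fx≤
... | v , fxv≤ = x ∷ v , fxv≤

-- By linearity, if each `b q` has mean at most `k / N`, the `c`-weighted sum has mean at most
-- `k / N` times `sum c`, and some vector does no worse than the mean. Asking for `h * suc k` rather
-- than `h * k` leaves a nonzero factor to cancel even when `k` is 0.
∑ⱽ-weighted-average : .{{NonZero N}} → ∀ h k m → h * suc k ≤ N → (b : Fin Q → Vec (Fin N) m → ℕ) →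
  (∀ q → N * ∑ⱽ N m (b q) ≤ k * N ^ m) →
  ∀ (c : Fin Q → ℕ) → ∃[ v ] h * ∑[ q < Q ] (c q * b q v) ≤ sum c
∑ⱽ-weighted-average {N} {Q} h k m hk≤N b ∑b≤ c = proj₁ light , *-cancelˡ-≤ (suc k) (begin
  suc k * (h * X)  ≡⟨ pull′ (suc k) h X ⟩
  h * suc k * X    ≤⟨ *-monoˡ-≤ X hk≤N ⟩
  N * X            ≤⟨ proj₂ light ⟩
  k * sum c        ≤⟨ *-monoˡ-≤ (sum c) (n≤1+n k) ⟩
  suc k * sum c    ∎)
  where
  open ≤-Reasoning
  pull : ∀ x y z → x * (y * z) ≡ y * (x * z)
  pull = solve-∀
  pull′ : ∀ x y z → x * (y * z) ≡ y * x * z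
  pull′ = solve-∀
  reverse : ∀ x y z → x * (y * z) ≡ z * (y * x)
  reverse = solve-∀
  total : ∑ⱽ N m (λ v → N * ∑[ q < Q ] (c q * b q v)) ≤ N ^ m * (k * sum c)
  total = begin
    ∑ⱽ N m (λ v → N * ∑[ q < Q ] (c q * b q v))  ≡⟨ ∑ⱽ-*ˡ m N _ ⟩
    N * ∑ⱽ N m (λ v → ∑[ q < Q ] (c q * b q v))  ≡⟨ cong (N *_) (∑ⱽ-∑-comm m (λ q v → c q * b q v)) ⟩
    N * ∑[ q < Q ] ∑ⱽ N m (λ v → c q * b q v)    ≡⟨ *-distribˡ-sum {Q} N _ ⟩
    ∑[ q < Q ] (N * ∑ⱽ N m (λ v → c q * b q v))  ≡⟨ sum-cong-≗ {Q} (λ q → trans (cong (N *_) (∑ⱽ-*ˡ m (c q) (b q)))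
                                                                           (pull N (c q) (∑ⱽ N m (b q)))) ⟩
    ∑[ q < Q ] (c q * (N * ∑ⱽ N m (b q)))        ≤⟨ ∑-mono (λ q → *-monoʳ-≤ (c q) (∑b≤ q)) ⟩
    ∑[ q < Q ] (c q * (k * N ^ m))               ≡⟨ sum-cong-≗ {Q} (λ q → reverse (c q) k (N ^ m)) ⟩
    ∑[ q < Q ] (N ^ m * (k * c q))               ≡⟨ *-distribˡ-sum {Q} (N ^ m) _ ⟨
    N ^ m * ∑[ q < Q ] (k * c q)                 ≡⟨ cong (N ^ m *_) (*-distribˡ-sum {Q} k c) ⟨
    N ^ m * (k * sum c)                          ∎
  light : ∃[ v ] N * ∑[ q < Q ] (c q * b q v) ≤ k * sum c
  light = ∑ⱽ-average m _ total
  X = ∑[ q < Q ] (c q * b q (proj₁ light))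

-- Once the coordinates other than `j` are fixed, at most one of the `N` values at `j` satisfies
-- `A`, so the event has probability at most `1 / N`. Multiplying by `N` clears the denominator.
∑ⱽ-𝟙-determined : ∀ m (j : Fin m) {A : Vec (Fin N) m → Set} (A? : Decidable A) →
  (∀ v w → (∀ i → i ≢ j → lookup v i ≡ lookup w i) → A v → A w → lookup v j ≡ lookup w j) →
  N * ∑ⱽ N m (λ v → 𝟙 (A? v)) ≤ N ^ m
∑ⱽ-𝟙-determined {N} (suc m) zero A? det = *-monoʳ-≤ N (begin
  -- The determined coordinate is moved to the innermost sum, which is then at most 1 for each tail
  -- `v`.
  ∑[ x < N ] ∑ⱽ N m (λ v → 𝟙 (A? (x ∷ v)))  ≡⟨ ∑ⱽ-∑-comm m (λ x v → 𝟙 (A? (x ∷ v))) ⟨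
  ∑ⱽ N m (λ v → ∑[ x < N ] 𝟙 (A? (x ∷ v)))  ≤⟨ ∑ⱽ-mono m (λ v → ∑-𝟙-unique (λ x → A? (x ∷ v)) (λ x y →
                                                 det (x ∷ v) (y ∷ v) λ { zero 0≢0 → contradiction refl 0≢0 ; (suc i) _ → refl })) ⟩
  ∑ⱽ N m (λ _ → 1)                          ≡⟨ ∑ⱽ-const N m 1 ⟩
  N ^ m * 1                                 ≡⟨ *-identityʳ _ ⟩
  N ^ m                                     ∎)
  where open ≤-Reasoning
∑ⱽ-𝟙-determined {N} (suc m) (suc j) A? det = begin
  N * ∑[ x < N ] ∑ⱽ N m (λ v → 𝟙 (A? (x ∷ v)))    ≡⟨ *-distribˡ-sum {N} N _ ⟩
  ∑[ x < N ] (N * ∑ⱽ N m (λ v → 𝟙 (A? (x ∷ v))))  ≤⟨ ∑-mono (λ x → ∑ⱽ-𝟙-determined m j (A? ∘ (x ∷_)) (det′ x)) ⟩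
  ∑[ x < N ] (N ^ m)                              ≡⟨ ∑-const N _ ⟩
  N * N ^ m                                       ∎
  where
  open ≤-Reasoning
  det′ : ∀ x v w → _ → _ → _ → _
  det′ x v w eq = det (x ∷ v) (x ∷ w) λ { zero _ → refl ; (suc i) si≢sj → eq i (si≢sj ∘ cong suc) }

-- The isolation lemma

weight-cong : {ω ω′ : Fin m → ℕ} (S : Subset m) → ω ≗ ω′ → weight ω S ≡ weight ω′ S
weight-cong []      eq = refl
weight-cong (b ∷ S) eq = cong₂ (λ x y → (if b then x else 0) + y) (eq zero) (weight-cong S (eq ∘ suc))

weight-∉ : (ω ω′ : Fin m → ℕ) (j : Fin m) → (∀ i → i ≢ j → ω i ≡ ω′ i) →
           ∀ S → j ∉ S → weight ω S ≡ weight ω′ S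
weight-∉ ω ω′ zero    eq (true  ∷ S) j∉S = contradiction here j∉S
weight-∉ ω ω′ zero    eq (false ∷ S) j∉S = weight-cong S (λ i → eq (suc i) λ ())
weight-∉ ω ω′ (suc j) eq (b     ∷ S) j∉S =
  cong₂ (λ x y → (if b then x else 0) + y) (eq zero λ ())
    (weight-∉ (ω ∘ suc) (ω′ ∘ suc) j (λ i i≢j → eq (suc i) (i≢j ∘ suc-injective)) S (j∉S ∘ there))

weight-∈ : (ω ω′ : Fin m → ℕ) (j : Fin m) → (∀ i → i ≢ j → ω i ≡ ω′ i) → ω j < ω′ j →
           ∀ S → j ∈ S → weight ω S < weight ω′ S
weight-∈ ω ω′ zero    eq ωj< (true ∷ S) here =
  +-mono-<-≤ ωj< (≤-reflexive (weight-cong S (λ i → eq (suc i) λ ())))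
weight-∈ ω ω′ (suc j) eq ωj< (b ∷ S) (there j∈S) =
  +-mono-≤-< (≤-reflexive (cong (if b then_else 0) (eq zero λ ())))
    (weight-∈ (ω ∘ suc) (ω′ ∘ suc) j (λ i i≢j → eq (suc i) (i≢j ∘ suc-injective)) ωj< S j∈S)

toWeight : Vec (Fin N) m → Fin m → ℕ
toWeight v = toℕ ∘ lookup v

module Isolation (P : Subset m → Set) (P? : Decidable P) where

  -- With `IsHC G` for `P`, this unfolds to `IsolatesHC`.
  Isolates : (Fin m → ℕ) → Set
  Isolates ω = Σ (Subset m) λ S → P S ×
    (∀ S′ → P S′ → weight ω S ≤ weight ω S′) ×
    (∀ S′ → P S′ → weight ω S′ ≡ weight ω S → S′ ≡ S)

  -- Minimality is the absence of a lighter solution, because an existential over subsets is decided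
  -- by `anySubset?`.
  Minimal : (Fin m → ℕ) → Subset m → Set
  Minimal ω S = P S × ¬ ∃ λ T → P T × weight ω T < weight ω S

  minimal? : ∀ ω → Decidable (Minimal ω)
  minimal? ω S = P? S ×-dec ¬? (anySubset? λ T → P? T ×-dec (weight ω T <? weight ω S))

  minimal-≤ : ∀ ω {S T} → Minimal ω S → P T → weight ω S ≤ weight ω T
  minimal-≤ ω (_ , noLighter) PT = ≮⇒≥ λ T<S → noLighter (_ , PT , T<S)

  minimal-exists : ∀ ω {S} → P S → ∃ (Minimal ω)
  minimal-exists ω PS = descend PS (<-wellFounded _)
    where
    descend : ∀ {S} → P S → Acc _<_ (weight ω S) → ∃ (Minimal ω)
    descend {S} PS (acc rec) with anySubset? (λ T → P? T ×-dec (weight ω T <? weight ω S))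
    ... | yes (T , PT , T<S) = descend PT (rec T<S)
    ... | no noLighter       = S , PS , noLighter

  -- The ambiguous elements of the isolation lemma: some minimum-weight solution contains `j` and
  -- another avoids it.
  TiedAt : (Fin m → ℕ) → Fin m → Set
  TiedAt ω j = ∃ λ S → (j ∈ S × Minimal ω S) × ∃ λ T → j ∉ T × Minimal ω T

  tiedAt? : ∀ ω → Decidable (TiedAt ω)
  tiedAt? ω j = anySubset? λ S → (j ∈? S ×-dec minimal? ω S) ×-dec
                anySubset? λ T → ¬? (j ∈? T) ×-dec minimal? ω T

  Tied : (Fin m → ℕ) → Set
  Tied ω = ∃ (TiedAt ω)

  tied? : Decidable Tied
  tied? ω = any? (tiedAt? ω)

  -- Two distinct minimal solutions differ in some element, and that element is tied. The given
  -- solution guarantees that a minimal one exists.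
  ¬tied⇒isolates : ∀ ω {S} → P S → ¬ Tied ω → Isolates ω
  ¬tied⇒isolates ω P₀ ¬tied with minimal-exists ω P₀
  ... | S , minS@(PS , _) = S , PS , (λ T → minimal-≤ ω minS) , unique
    where
    unique : ∀ T → P T → weight ω T ≡ weight ω S → T ≡ S
    unique T PT T≡S = ⊆-antisym
      (λ {j} j∈T → decidable-stable (j ∈? S) λ j∉S → ¬tied (j , T , (j∈T , minT) , S , j∉S , minS))
      (λ {j} j∈S → decidable-stable (j ∈? T) λ j∉T → ¬tied (j , S , (j∈S , minS) , T , j∉T , minT))
      where
      minT : Minimal ω T
      minT = PT , λ (U , PU , U<T) → <-irrefl refl (<-≤-trans U<T (≤-trans (≤-reflexive T≡S) (minimal-≤ ω minS PU)))

  -- Raising ω j makes every solution through j heavier and leaves the others unchanged.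
  ¬tiedAt-raised : ∀ ω ω′ j → (∀ i → i ≢ j → ω i ≡ ω′ i) → ω j < ω′ j → TiedAt ω j → ¬ TiedAt ω′ j
  ¬tiedAt-raised ω ω′ j eq ωj< (_ , _ , S′ , j∉S′ , minS′@(PS′ , _)) (T , (j∈T , minT@(PT , _)) , _) =
    <-irrefl refl (begin-strict
      weight ω′ T   ≤⟨ minimal-≤ ω′ minT PS′ ⟩
      weight ω′ S′  ≡⟨ weight-∉ ω ω′ j eq S′ j∉S′ ⟨
      weight ω S′   ≤⟨ minimal-≤ ω minS′ PT ⟩
      weight ω T    <⟨ weight-∈ ω ω′ j eq ωj< T j∈T ⟩
      weight ω′ T   ∎)
    where open ≤-Reasoning

  -- The threshold argument: of two distinct values at `j`, one is a raise of the other, and a raise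
  -- destroys the tie.
  tiedAt-determined : ∀ ω ω′ j → (∀ i → i ≢ j → ω i ≡ ω′ i) → TiedAt ω j → TiedAt ω′ j → ω j ≡ ω′ j
  tiedAt-determined ω ω′ j eq tied tied′ with <-cmp (ω j) (ω′ j)
  ... | tri≈ _ ωj≡ _ = ωj≡
  ... | tri< ωj< _ _ = contradiction tied′ (¬tiedAt-raised ω ω′ j eq ωj< tied)
  ... | tri> _ _ ωj> = contradiction tied (¬tiedAt-raised ω′ ω j (λ i i≢j → sym (eq i i≢j)) ωj> tied′)

  -- A union bound over the `m` elements: each is tied with probability at most `1 / N`, since its
  -- weight is determined by the others.
  #tied : ∀ N → N * ∑ⱽ N m (λ v → 𝟙 (tied? (toWeight v))) ≤ m * N ^ m
  #tied N = begin
    N * ∑ⱽ N m (λ v → 𝟙 (tied? (toWeight v)))       ≤⟨ *-monoʳ-≤ N (∑ⱽ-mono m λ v → 𝟙-any≤∑ _ (tied? (toWeight v))) ⟩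
    N * ∑ⱽ N m (λ v → ∑[ j < m ] 𝟙 (tiedAtⱽ? j v))  ≡⟨ cong (N *_) (∑ⱽ-∑-comm m λ j v → 𝟙 (tiedAtⱽ? j v)) ⟩
    N * ∑[ j < m ] ∑ⱽ N m (λ v → 𝟙 (tiedAtⱽ? j v))  ≡⟨ *-distribˡ-sum {m} N _ ⟩
    ∑[ j < m ] (N * ∑ⱽ N m (λ v → 𝟙 (tiedAtⱽ? j v))) ≤⟨ ∑-mono (λ j → ∑ⱽ-𝟙-determined m j (tiedAtⱽ? j) (determined j)) ⟩
    ∑[ j < m ] (N ^ m)                              ≡⟨ ∑-const m _ ⟩
    m * N ^ m                                       ∎
    where
    open ≤-Reasoning
    tiedAtⱽ? : ∀ j → Decidable (λ (v : Vec (Fin N) m) → TiedAt (toWeight v) j)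
    tiedAtⱽ? j v = tiedAt? (toWeight v) j
    determined : ∀ j (v w : Vec (Fin N) m) → (∀ i → i ≢ j → lookup v i ≡ lookup w i) →
                 TiedAt (toWeight v) j → TiedAt (toWeight w) j → lookup v j ≡ lookup w j
    determined j v w eq tv tw = toℕ-injective
      (tiedAt-determined (toWeight v) (toWeight w) j (λ i i≢j → cong toℕ (eq i i≢j)) tv tw)

-- Derandomised union bound

∁-majority : (F : Subset n) → 2 * ∣ F ∣ ≤ n → n ≤ 2 * ∣ ∁ F ∣
∁-majority {n} F 2∣F∣≤n = begin
  n                      ≡⟨ m+n∸n≡m n n ⟨
  n + n ∸ n              ≤⟨ ∸-monoʳ-≤ (n + n) 2∣F∣≤n ⟩
  n + n ∸ 2 * ∣ F ∣      ≡⟨ cong (λ x → n + x ∸ 2 * ∣ F ∣) (+-identityʳ n) ⟨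
  2 * n ∸ 2 * ∣ F ∣      ≡⟨ *-distribˡ-∸ 2 n ∣ F ∣ ⟨
  2 * (n ∸ ∣ F ∣)        ≡⟨ cong (2 *_) (∣∁p∣≡n∸∣p∣ F) ⟨
  2 * ∣ ∁ F ∣            ∎
  where open ≤-Reasoning

-- `Q` instances share one sequence of draws from `W`. The hypothesis `pick` says that under any
-- weighting of the instances, some single draw fails on at most 1/15 of the total weight.
module Majority {W : Set} {Bad : Fin Q → W → Set} (bad? : ∀ q → Decidable (Bad q))
  (pick : ∀ (c : Fin Q → ℕ) → ∃[ w ] 15 * ∑[ q < Q ] (c q * 𝟙 (bad? q w)) ≤ sum c) where

  failures : Fin Q → Vec W l → Subset l
  failures q = map (does ∘ bad? q)

  -- A failure multiplies the weight of q by 16. With a failing fraction of at most 1/15 the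
  -- total weight at most doubles per draw, whereas failing on half of the draws costs 4 per draw.
  greedy : ∀ ℓ (c : Fin Q → ℕ) → Σ (Vec W ℓ) λ ws →
           ∑[ q < Q ] (c q * 16 ^ ∣ failures q ws ∣) ≤ 2 ^ ℓ * sum c
  greedy zero c = [] , ≤-reflexive (trans (sum-cong-≗ (λ q → *-identityʳ (c q))) (sym (+-identityʳ _)))
  greedy (suc ℓ) c with pick c
  -- The updated weight is 16 times `c q` on a failure and `c q` otherwise, written as an increment
  -- so that `picked` bounds its sum directly.
  ... | w , picked with greedy ℓ (λ q → c q + 15 * (c q * 𝟙 (bad? q w)))
  ...   | ws , bound = w ∷ ws , (begin
    ∑[ q < Q ] (c q * 16 ^ ∣ failures q (w ∷ ws) ∣)                             ≡⟨ sum-cong-≗ split ⟩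
    ∑[ q < Q ] ((c q + 15 * (c q * 𝟙 (bad? q w))) * 16 ^ ∣ failures q ws ∣)     ≤⟨ bound ⟩
    2 ^ ℓ * ∑[ q < Q ] (c q + 15 * (c q * 𝟙 (bad? q w)))                        ≡⟨ cong (2 ^ ℓ *_) (∑-distrib-+ {Q} c _) ⟩
    2 ^ ℓ * (sum c + ∑[ q < Q ] (15 * (c q * 𝟙 (bad? q w))))                    ≡⟨ cong (λ x → 2 ^ ℓ * (sum c + x)) (*-distribˡ-sum {Q} 15 _) ⟨
    2 ^ ℓ * (sum c + 15 * ∑[ q < Q ] (c q * 𝟙 (bad? q w)))                      ≤⟨ *-monoʳ-≤ (2 ^ ℓ) (+-monoʳ-≤ (sum c) picked) ⟩
    2 ^ ℓ * (sum c + sum c)                                                     ≡⟨ double (2 ^ ℓ) (sum c) ⟩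
    2 * 2 ^ ℓ * sum c                                                           ∎)
    where
    open ≤-Reasoning
    double : ∀ x y → x * (y + y) ≡ 2 * x * y
    double = solve-∀
    charge : ∀ x y → x * (16 * y) ≡ (x + 15 * (x * 1)) * y
    charge = solve-∀
    keep : ∀ x y → x * y ≡ (x + 15 * (x * 0)) * y
    keep = solve-∀
    split : ∀ q → c q * 16 ^ ∣ failures q (w ∷ ws) ∣ ≡ (c q + 15 * (c q * 𝟙 (bad? q w))) * 16 ^ ∣ failures q ws ∣
    split q with bad? q w
    ... | yes _ = charge (c q) _
    ... | no _  = keep (c q) _

  -- From unit weights, the final potential is at most `2 ^ ℓ * Q`, hence at most `4 ^ ℓ`. An
  -- instance failing on more than half of the draws would alone contribute more than that.
  majority : ∀ ℓ → Q ≤ 2 ^ ℓ → Σ (Vec W ℓ) λ ws → ∀ q → 2 * ∣ failures q ws ∣ ≤ ℓ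
  majority ℓ Q≤2^ℓ with greedy ℓ (λ _ → 1)
  ... | ws , bound = ws , λ q → ≮⇒≥ λ ℓ<2∣F∣ → <-irrefl refl (begin-strict
    4 ^ ℓ                                      <⟨ ^-monoʳ-< 4 (s≤s (s≤s z≤n)) ℓ<2∣F∣ ⟩
    4 ^ (2 * ∣ failures q ws ∣)                ≡⟨ ^-*-assoc 4 2 ∣ failures q ws ∣ ⟨
    16 ^ ∣ failures q ws ∣                     ≡⟨ *-identityˡ _ ⟨
    1 * 16 ^ ∣ failures q ws ∣                 ≤⟨ term≤∑ (λ q → 1 * 16 ^ ∣ failures q ws ∣) q ⟩
    ∑[ q < Q ] (1 * 16 ^ ∣ failures q ws ∣)    ≤⟨ bound ⟩
    2 ^ ℓ * ∑[ q < Q ] 1                       ≡⟨ cong (2 ^ ℓ *_) (trans (∑-const Q 1) (*-identityʳ Q)) ⟩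
    2 ^ ℓ * Q                                  ≤⟨ *-monoʳ-≤ (2 ^ ℓ) Q≤2^ℓ ⟩
    2 ^ ℓ * 2 ^ ℓ                              ≡⟨ ^-distribˡ-+-* 2 ℓ ℓ ⟨
    2 ^ (ℓ + ℓ)                                ≡⟨ cong (λ x → 2 ^ (ℓ + x)) (+-identityʳ ℓ) ⟨
    2 ^ (2 * ℓ)                                ≡⟨ ^-*-assoc 2 2 ℓ ⟨
    4 ^ ℓ                                      ∎)
    where open ≤-Reasoning

-- The isolation lemma supplies the draws for the union bound: with `M` weight values a draw fails
-- with probability at most `m / M`, and the bound on `M` keeps this below 1/15.
module Schemes {P : Fin Q → Subset m → Set} (P? : ∀ q → Decidable (P q))
  (M : ℕ) .{{_ : NonZero M}} (15*suc-m≤M : 15 * suc m ≤ M) where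

  private module I q = Isolation (P q) (P? q)

  W : Set
  W = Vec (Fin M) m

  bad? : ∀ q → Decidable (λ (v : W) → I.Tied q (toWeight v))
  bad? q v = I.tied? q (toWeight v)

  pick : ∀ (c : Fin Q → ℕ) → ∃[ v ] 15 * ∑[ q < Q ] (c q * 𝟙 (bad? q v)) ≤ sum c
  pick = ∑ⱽ-weighted-average 15 m m 15*suc-m≤M (λ q v → 𝟙 (bad? q v)) (λ q → I.#tied q M)

  open Majority bad? pick

  scheme : ∀ ℓ → Q ≤ 2 ^ ℓ → Σ (Fin ℓ → Fin m → ℕ) λ ω →
    (∀ i e → ω i e ≤ M) ×
    (∀ q {S} → P q S → Σ (Subset ℓ) λ I → (ℓ ≤ 2 * ∣ I ∣) × (∀ i → i ∈ I → I.Isolates q (ω i)))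
  scheme ℓ Q≤2^ℓ = ω , (λ i e → <⇒≤ (toℕ<n _)) ,
    λ q PS → ∁ (failures q vs) , many q , λ i i∈ → isolates q PS i (x∈∁p⇒x∉p i∈)
    where
    vs : Vec W ℓ
    vs = proj₁ (majority ℓ Q≤2^ℓ)

    ω : Fin ℓ → Fin m → ℕ
    ω i = toWeight (lookup vs i)

    many : ∀ q → ℓ ≤ 2 * ∣ ∁ (failures q vs) ∣
    many q = ∁-majority (failures q vs) (proj₂ (majority ℓ Q≤2^ℓ) q)

    isolates : ∀ q {S} → P q S → ∀ i → i ∉ failures q vs → I.Isolates q (ω i)
    isolates q PS i i∉ = I.¬tied⇒isolates q (ω i) PS λ tied → i∉ (lookup⇒[]= i _
      (trans (lookup-map i _ vs) (dec-true (bad? q (lookup vs i)) tied)))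

-- Hamiltonian cycles of edge enumerations

-- The vertex order `σ` is a parameter so that a finite search over all orders decides the existence
-- of a cycle.
CycleAlong : (Fin m → Fin n × Fin n) → (Fin n → Fin n) → Subset m → Set
CycleAlong f σ S =
  Injective _≡_ _≡_ σ ×
  (∀ i k → Next i k → ∃[ j ] (j ∈ S × Joined j (σ i) (σ k))) ×
  (∀ j → j ∈ S → ∃[ i ] ∃[ k ] (Next i k × Joined j (σ i) (σ k)))
  where
  Joined : _ → _ → _ → Set
  Joined j u v = (f j ≡ (u , v)) ⊎ (f j ≡ (v , u))

-- IsHC for an arbitrary edge function, so that the union bound can run over all of them,
-- graphs or not; IsHC′ (edge G) unfolds to IsHC G.
IsHC′ : (Fin m → Fin n × Fin n) → Subset m → Set
IsHC′ {n = n} f S = (3 ≤ n) × ∃ λ σ → CycleAlong f σ S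

-- Decoding a coded function returns it only up to pointwise equality, so cycles have to be
-- transported along `≗` in both the edge function and the vertex order.
cycleAlong-cong : {f g : Fin m → Fin n × Fin n} {σ τ : Fin n → Fin n} {S : Subset m} →
                  f ≗ g → σ ≗ τ → CycleAlong f σ S → CycleAlong g τ S
cycleAlong-cong {f = f} {g} {σ} {τ} f≗g σ≗τ (inj , cover , used) =
  (λ {x} {y} eq → inj (trans (σ≗τ x) (trans eq (sym (σ≗τ y))))) ,
  (λ i k nx → let j , j∈S , e = cover i k nx in j , j∈S , joined j i k e) ,
  (λ j j∈S → let i , k , nx , e = used j j∈S in i , k , nx , joined j i k e)
  where
  joined : ∀ j i k → (f j ≡ (σ i , σ k)) ⊎ (f j ≡ (σ k , σ i)) → (g j ≡ (τ i , τ k)) ⊎ (g j ≡ (τ k , τ i))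
  joined j i k rewrite f≗g j | σ≗τ i | σ≗τ k = λ e → e

cycleAlong? : ∀ (f : Fin m → Fin n × Fin n) σ → Decidable (CycleAlong f σ)
cycleAlong? {n = n} f σ S =
  map′ (λ inj {x} {y} → inj x y) (λ inj x y → inj) (all? λ x → all? λ y → (σ x ≟ σ y) →-dec (x ≟ y))
  ×-dec (all? λ i → all? λ k → next? i k →-dec any? λ j → (j ∈? S) ×-dec joined? j (σ i) (σ k))
  ×-dec (all? λ j → (j ∈? S) →-dec any? λ i → any? λ k → next? i k ×-dec joined? j (σ i) (σ k))
  where
  next? : ∀ (i k : Fin n) → Dec (Next i k)
  next? i k = (suc (toℕ i) ≟ℕ toℕ k) ⊎-dec ((suc (toℕ i) ≟ℕ n) ×-dec (toℕ k ≟ℕ 0))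
  joined? : ∀ j u v → Dec ((f j ≡ (u , v)) ⊎ (f j ≡ (v , u)))
  joined? j u v = ×-≡-dec _≟_ _≟_ (f j) (u , v) ⊎-dec ×-≡-dec _≟_ _≟_ (f j) (v , u)

isHC′? : ∀ (f : Fin m → Fin n × Fin n) → Decidable (IsHC′ f)
isHC′? {n = n} f S = (3 ≤? n) ×-dec
  map′ (λ (k , cyc) → finToFun k , cyc)
       (λ (σ , cyc) → funToFin σ , cycleAlong-cong (λ _ → refl) (λ i → sym (finToFun-funToFin σ i)) cyc)
       (any? {n = n ^ n} λ k → cycleAlong? f (finToFun k) S)

isHC′-cong : {f g : Fin m → Fin n × Fin n} {S : Subset m} → f ≗ g → IsHC′ f S → IsHC′ g S
isHC′-cong f≗g (3≤n , σ , cyc) = 3≤n , σ , cycleAlong-cong f≗g (λ _ → refl) cyc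

-- The code is a string of `m` digits in base `n * n`, each digit being a pair of vertices.
decode : ∀ n m → Fin ((n * n) ^ m) → Fin m → Fin n × Fin n
decode n m q = remQuot n ∘ finToFun q

encode : (Fin m → Fin n × Fin n) → Fin ((n * n) ^ m)
encode f = funToFin (λ j → combine (proj₁ (f j)) (proj₂ (f j)))

decode-encode : (f : Fin m → Fin n × Fin n) → decode n m (encode f) ≗ f
decode-encode f j = trans (cong (remQuot _) (finToFun-funToFin _ j)) (remQuot-combine _ _)

decodedHC? : ∀ n m (q : Fin ((n * n) ^ m)) → Decidable (IsHC′ (decode n m q))
decodedHC? n m q = isHC′? (decode n m q)

#edges≤ : Graph n m → m ≤ n * n
#edges≤ G = injective⇒≤ {f = λ j → combine (proj₁ (edge G j)) (proj₂ (edge G j))}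
  λ eq → let p , q = combine-injective _ _ _ _ eq in edge-inj G (cong₂ _,_ p q)

isolatesHC : {f : Fin m → Fin n × Fin n} (G : Graph n m) (ω : Fin m → ℕ) → f ≗ edge G →
             Isolation.Isolates (IsHC′ f) (isHC′? f) ω → IsolatesHC ω G
isolatesHC G ω f≗ (S , hc , lightest , unique) =
  S , isHC′-cong f≗ hc , (λ T → lightest T ∘ isHC′-cong (sym ∘ f≗)) , (λ T → unique T ∘ isHC′-cong (sym ∘ f≗))

-- Choice of parameters

2^n+2^n≡2^suc : ∀ n → 2 ^ n + 2 ^ n ≡ 2 ^ suc n
2^n+2^n≡2^suc n = cong (2 ^ n +_) (sym (+-identityʳ (2 ^ n)))

suc≤2^suc : ∀ n → k ≤ 2 ^ n → suc k ≤ 2 ^ suc n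
suc≤2^suc n k≤ = ≤-trans (+-mono-≤ (m^n>0 2 n) k≤) (≤-reflexive (2^n+2^n≡2^suc n))

n≤2^n : ∀ n → n ≤ 2 ^ n
n≤2^n zero    = z≤n
n≤2^n (suc n) = suc≤2^suc n (n≤2^n n)

n*n≤2^[n+n] : ∀ n → n * n ≤ 2 ^ (n + n)
n*n≤2^[n+n] n = ≤-trans (*-mono-≤ (n≤2^n n) (n≤2^n n)) (≤-reflexive (sym (^-distribˡ-+-* 2 n n)))

HCScheme : ℕ → ℕ → ℕ → Set
HCScheme C n m =
  Σ ℕ λ ℓ → Σ (Fin ℓ → Fin m → ℕ) λ ω →
  (1 ≤ ℓ) × (ℓ ≤ 2 ^ (C * n)) ×
  (∀ i e → ω i e ≤ 2 ^ (C * n)) ×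
  (∀ (G : Graph n m) → Hamiltonian G →
  Σ (Subset ℓ) λ I → (ℓ ≤ 2 * ∣ I ∣) × (∀ i → i ∈ I → IsolatesHC (ω i) G))

trivialScheme : ∀ C n m → (∀ (G : Graph n m) → ¬ Hamiltonian G) → HCScheme C n m
trivialScheme C n m none =
  1 , (λ _ _ → 0) , ≤-refl , m^n>0 2 (C * n) , (λ _ _ → z≤n) , λ G ham → contradiction ham (none G)

hcScheme : .{{NonZero n}} → m ≤ n * n → HCScheme 7 n m
hcScheme {n} {m} m≤n*n =
  ℓ , proj₁ schemes , s≤s z≤n , ℓ≤ , proj₁ (proj₂ schemes) ,
  -- The scheme serves every code, so `G` is handled through its own code and the result is carried
  -- back.
  λ G (S , hc) →
    let I , large , isolated = proj₂ (proj₂ schemes) (encode (edge G))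
                                 (isHC′-cong (sym ∘ decode-encode (edge G)) hc)
    in  I , large , λ i i∈I → isolatesHC G _ (decode-encode (edge G)) (isolated i i∈I)
  where
  open ≤-Reasoning

  -- There are at most `2 ^ ((n + n) * m)` codes, so this many draws satisfy the union bound. The
  -- successor keeps `ℓ` positive when `m` is 0.
  ℓ : ℕ
  ℓ = suc ((n + n) * m)

  m≤2^[n+n] : m ≤ 2 ^ (n + n)
  m≤2^[n+n] = ≤-trans m≤n*n (n*n≤2^[n+n] n)

  -- As `n` is at least 1, additive constants are absorbed into multiples of `n`. The constant 7
  -- comes from the exponent `5 + 2 * n` required of the weight range.
  exponent≤ : ∀ a b → a + b ≡ 7 → a + b * n ≤ 7 * n
  exponent≤ a b a+b≡7 = begin
    a + b * n      ≤⟨ +-monoˡ-≤ (b * n) (m≤m*n a n) ⟩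
    a * n + b * n  ≡⟨ *-distribʳ-+ n a b ⟨
    (a + b) * n    ≡⟨ cong (_* n) a+b≡7 ⟩
    7 * n          ∎

  ℓ≤ : ℓ ≤ 2 ^ (7 * n)
  ℓ≤ = begin
    suc ((n + n) * m)             ≤⟨ suc≤2^suc (suc n + (n + n)) (begin
      (n + n) * m                   ≤⟨ *-mono-≤ (+-mono-≤ (n≤2^n n) (n≤2^n n)) m≤2^[n+n] ⟩
      (2 ^ n + 2 ^ n) * 2 ^ (n + n) ≡⟨ cong (_* 2 ^ (n + n)) (2^n+2^n≡2^suc n) ⟩
      2 ^ suc n * 2 ^ (n + n)       ≡⟨ ^-distribˡ-+-* 2 (suc n) (n + n) ⟨
      2 ^ (suc n + (n + n))         ∎) ⟩
    -- The exponent `2 + 3 * n` is padded by 2 to fit `exponent≤` with 4 and 3.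
    2 ^ suc (suc n + (n + n))     ≤⟨ ^-monoʳ-≤ 2 (m≤m+n (suc (suc n + (n + n))) 2) ⟩
    2 ^ (suc (suc n + (n + n)) + 2) ≡⟨ cong (2 ^_) (collect n) ⟩
    2 ^ (4 + 3 * n)               ≤⟨ ^-monoʳ-≤ 2 (exponent≤ 4 3 refl) ⟩
    2 ^ (7 * n)                   ∎
    where
    collect : ∀ n → suc (suc n + (n + n)) + 2 ≡ 4 + 3 * n
    collect = solve-∀

  15*suc-m≤ : 15 * suc m ≤ 2 ^ (7 * n)
  15*suc-m≤ = begin
    15 * suc m              ≤⟨ *-mono-≤ (n≤1+n 15) (suc≤2^suc (n + n) m≤2^[n+n]) ⟩
    2 ^ 4 * 2 ^ suc (n + n) ≡⟨ ^-distribˡ-+-* 2 4 (suc (n + n)) ⟨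
    2 ^ (4 + suc (n + n))   ≡⟨ cong (2 ^_) (collect n) ⟩
    2 ^ (5 + 2 * n)         ≤⟨ ^-monoʳ-≤ 2 (exponent≤ 5 2 refl) ⟩
    2 ^ (7 * n)             ∎
    where
    collect : ∀ n → 4 + suc (n + n) ≡ 5 + 2 * n
    collect = solve-∀

  #graphs≤ : (n * n) ^ m ≤ 2 ^ ℓ
  #graphs≤ = begin
    (n * n) ^ m         ≤⟨ ^-monoˡ-≤ m (n*n≤2^[n+n] n) ⟩
    (2 ^ (n + n)) ^ m   ≡⟨ ^-*-assoc 2 (n + n) m ⟩
    2 ^ ((n + n) * m)   ≤⟨ ^-monoʳ-≤ 2 (n≤1+n ((n + n) * m)) ⟩
    2 ^ ℓ               ∎

  schemes = Schemes.scheme (decodedHC? n m) (2 ^ (7 * n)) {{m^n≢0 2 (7 * n)}} 15*suc-m≤ ℓ #graphs≤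

theorem1p1 : ∃[ C ] ∀ (n m : ℕ) →
    Σ ℕ λ ℓ → Σ (Fin ℓ → Fin m → ℕ) λ ω →
    (1 ≤ ℓ) × (ℓ ≤ 2 ^ (C * n)) ×
    (∀ i e → ω i e ≤ 2 ^ (C * n)) ×
    (∀ (G : Graph n m) → Hamiltonian G →
    Σ (Subset ℓ) λ I → (ℓ ≤ 2 * ∣ I ∣) × (∀ i → i ∈ I → IsolatesHC (ω i) G))
theorem1p1 = 7 , construct
  where
  construct : ∀ n m → HCScheme 7 n m
  -- For `n` equal to 0 both bounds are 1, too small for the random construction, but a Hamiltonian
  -- cycle needs three vertices.
  construct zero      m = trivialScheme 7 zero m λ { G (_ , () , _) }
  construct n@(suc _) m with m ≤? n * n
  ... | yes m≤n*n = hcScheme m≤n*n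
  ... | no m≰n*n  = trivialScheme 7 n m λ G _ → m≰n*n (#edges≤ G)
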